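{- Let $n\ge 1$, let $w\in\mathfrak{S}_n$, and let $(u,v)=(u(w),v(w))$ be the pair of words in transpositions output by the algorithm SHALLOW-DECOMP on input $w$. Then the concatenation $uv=t_1t_2\cdots t_k$ is an expression of $w$ as a product of transpositions that has minimal reflection length (i.e. $k=\ell_T(w)$) and minimal depth (i.e. the sum of the depths of the $t_i$ equals $\mathrm{dp}(w)$). Moreover, this depth is equal to $$\mathrm{dp}(w)=\sum_{w(i)>i}(w(i)-i),$$ and the expression corresponds to a directed path in the Bruhat graph of $\mathfrak{S}_n$ from the identity to $w$, namely $e\to t_1\to t_1t_2\to\cdots\to t_1t_2\cdots t_k=w$.
   Context: $\mathfrak{S}_n$ is the group of permutations of $\{1,\dots,n\}$, with product given by composition of functions, $(xy)(i)=x(y(i))$. For $1\le i<j\le n$, $t_{ij}=t_{i,j}$ denotes the transposition interchanging $i$ and $j$; its depth is $j-i$. The depth $\mathrm{dp}(w)$ is the minimum, over all factorizations of $w$ into transpositions, of the sum of the depths of the factors. $\ell_T(w)$ (reflection length) is the minimal number of transpositions whose product is $w$; $\ell_S(w)$ (length) is the minimal number of adjacent transpositions $t_{i,i+1}$ whose product is $w$. The Bruhat graph of $\mathfrak{S}_n$ is the directed graph with vertex set $\mathfrak{S}_n$ and an edge $x\to y$ if and only if $y=xt$ for some transposition $t$ and $\ell_S(x)<\ell_S(y)$. Algorithm SHALLOW-DECOMP. The input is $w\in\mathfrak{S}_n$; the output is a pair of words $u=u(w)$, $v=v(w)$ in transpositions, defined recursively. (1) If $n=1$, then $u$ and $v$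 are both the empty word (the identity). (2) If $n>1$ and $w(n)=n$, let $w'=w(1)\cdots w(n-1)\in\mathfrak{S}_{n-1}$ and set $u(w)=u(w')$, $v(w)=v(w')$. (3) If $n>1$ and $w(n)<n$, let $w'=t_{w(n),n}\cdot w$ (so $w'(n)=n$) and: (a) if $w(n)\le w^{ -1}(n)$, set $u(w)=u(w')$ and $v(w)=v(w')\cdot t_{w^{ -1}(n),n}$; (b) if $w(n)>w^{ -1}(n)$, set $u(w)=t_{w(n),n}\cdot u(w')$ and $v(w)=v(w')$. -}

module Defs where

open import Data.Nat.Base as ℕ using (ℕ; zero; suc; _∸_)
open import Data.Nat.ListAction using (sum)
open import Data.Fin.Base using (Fin; toℕ; fromℕ; inject₁; _<_)
open import Data.Fin.Properties
  using (_≟_; _≤?_; _<?_; toℕ-inject₁; ≤fromℕ; ≤∧≢⇒<)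
open import Data.Fin.Permutation
  using (Permutation′; _⟨$⟩ʳ_; _⟨$⟩ˡ_; _≈_; _∘ₚ_; id; transpose; remove; inverseʳ)
open import Data.List.Base
  using (List; []; _∷_; [_]; _++_; map; length; foldr; filter; inits; allFin)
open import Data.List.Relation.Unary.All using (All)
open import Data.List.Relation.Unary.Linked using (Linked)
open import Data.Product.Base using (∃-syntax; ∃₂; _×_; _,_)
import Data.Product.Base as Product
open import Function.Base using (_∘_)
open import Relation.Binary.PropositionalEquality
  using (_≡_; _≢_; sym; trans; cong; subst₂)
open import Relation.Nullary using (yes; no)

-- 𝔖ₙ is Permutation′ n, acting on Fin n = {0, …, n-1} instead of {1, …, n}.
-- Equality of permutations is the pointwise _≈_.

-- (x · y)(i) = x(y(i)); note that _∘ₚ_ composes in diagrammatic order.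
infixl 7 _·_
_·_ : ∀ {n} → Permutation′ n → Permutation′ n → Permutation′ n
x · y = y ∘ₚ x

record Transposition (n : ℕ) : Set where
  constructor t⟨_,_,_⟩
  field
    lo    : Fin n
    hi    : Fin n
    lo<hi : lo < hi

open Transposition public

⟦_⟧ : ∀ {n} → Transposition n → Permutation′ n
⟦ t ⟧ = transpose (lo t) (hi t)

depthₜ : ∀ {n} → Transposition n → ℕ
depthₜ t = toℕ (hi t) ∸ toℕ (lo t)

Adjacent : ∀ {n} → Transposition n → Set
Adjacent t = toℕ (hi t) ≡ suc (toℕ (lo t))

Word : ℕ → Set
Word n = List (Transposition n)

∏ : ∀ {n} → Word n → Permutation′ n
∏ = foldr (λ t x → ⟦ t ⟧ · x) id

depth : ∀ {n} → Word n → ℕ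
depth = sum ∘ map depthₜ

IsMinimum : ∀ {A : Set} → (A → Set) → (A → ℕ) → ℕ → Set
IsMinimum P cost k = (∃[ a ] (P a × cost a ≡ k)) × (∀ a → P a → k ℕ.≤ cost a)

-- dp, ℓ_T and ℓ_S are given by their graphs: `IsDp w d` says dp(w) = d, etc.
-- A minimum is unique, so these relations are functional in w.

IsDp : ∀ {n} → Permutation′ n → ℕ → Set
IsDp w = IsMinimum (λ ts → ∏ ts ≈ w) depth

IsReflectionLength : ∀ {n} → Permutation′ n → ℕ → Set
IsReflectionLength w = IsMinimum (λ ts → ∏ ts ≈ w) length

IsLength : ∀ {n} → Permutation′ n → ℕ → Set
IsLength w = IsMinimum (λ ts → All Adjacent ts × ∏ ts ≈ w) length

-- Edges of the Bruhat graph; the second factor says ℓ_S(x) < ℓ_S(y).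
infix 4 _⟶_
_⟶_ : ∀ {n} → Permutation′ n → Permutation′ n → Set
x ⟶ y = (∃[ t ] y ≈ x · ⟦ t ⟧)
      × (∃₂ λ a b → IsLength x a × IsLength y b × a ℕ.< b)

-- For t₁ ⋯ tₖ the vertices are e, t₁, t₁t₂, …, t₁t₂⋯tₖ, in this order.
IsBruhatPath : ∀ {n} → Word n → Set
IsBruhatPath ts = Linked _⟶_ (map ∏ (inits ts))

-- Σ_{w(i) > i} (w(i) - i)
excedanceSum : ∀ {n} → Permutation′ n → ℕ
excedanceSum {n} w =
  sum (map (λ i → toℕ (w ⟨$⟩ʳ i) ∸ toℕ i) (filter (λ i → i <? w ⟨$⟩ʳ i) (allFin n)))

-- 𝔖ₙ ⊂ 𝔖ₙ₊₁ as the permutations fixing the largest point.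
extendₜ : ∀ {n} → Transposition n → Transposition (suc n)
extendₜ t⟨ i , j , i<j ⟩ =
  t⟨ inject₁ i , inject₁ j
   , subst₂ ℕ._<_ (sym (toℕ-inject₁ i)) (sym (toℕ-inject₁ j)) i<j ⟩

extend : ∀ {n} → Word n → Word (suc n)
extend = map extendₜ

-- The transposition t_{i,n} in one-based notation, for i ≠ n.
t-last : ∀ {n} (i : Fin (suc n)) → i ≢ fromℕ n → Transposition (suc n)
t-last {n} i i≢n = t⟨ i , fromℕ n , ≤∧≢⇒< (≤fromℕ i) i≢n ⟩

from-last-≢ : ∀ {n} (w : Permutation′ (suc n)) →
              w ⟨$⟩ʳ fromℕ n ≢ fromℕ n → w ⟨$⟩ˡ fromℕ n ≢ fromℕ n
from-last-≢ w wn≢n eq = wn≢n (trans (cong (w ⟨$⟩ʳ_) (sym eq)) (inverseʳ w))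

-- `shallowDecomp n` takes its input in 𝔖ₙ₊₁, so `zero` is the case 𝔖₁.
shallowDecomp : ∀ n → Permutation′ (suc n) → Word (suc n) × Word (suc n)

-- The pair (u(w), v(w)) for w fixing its largest point: `remove` of that point
-- deletes the last entry of the one-line notation of w.
decompRestriction : ∀ n → Permutation′ (suc (suc n)) →
                    Word (suc (suc n)) × Word (suc (suc n))
decompRestriction n w =
  Product.map extend extend (shallowDecomp n (remove (fromℕ (suc n)) w))

-- w′ = t_{w(n),n} · w fixes n, so (u(w′), v(w′)) is computed from its restriction
-- directly; this makes the recursion structural.
shallowDecomp zero    w = [] , []
shallowDecomp (suc n) w with w ⟨$⟩ʳ fromℕ (suc n) ≟ fromℕ (suc n)
... | yes _ = decompRestriction n w
... | no wn≢n with w ⟨$⟩ʳ fromℕ (suc n) ≤? w ⟨$⟩ˡ fromℕ (suc n)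
...   | yes _ =
  let t     = t-last (w ⟨$⟩ʳ fromℕ (suc n)) wn≢n
      t′    = t-last (w ⟨$⟩ˡ fromℕ (suc n)) (from-last-≢ w wn≢n)
      u , v = decompRestriction n (⟦ t ⟧ · w)
  in  u , v ++ [ t′ ]
...   | no _ =
  let t     = t-last (w ⟨$⟩ʳ fromℕ (suc n)) wn≢n
      u , v = decompRestriction n (⟦ t ⟧ · w)
  in  t ∷ u , v

-- Correctness of the word uv, minimality of its length and of its depth, and the Bruhat
-- path are each shown by induction along the algorithm, which deletes n from its cycle.
--
-- Reflection length: contracting n turns any word for w into a word for w′ without n that
-- is no longer, and strictly shorter if w moves n.
-- Depth: multiplying by a transposition raises Σ max(w(i) - i, 0) by at most its depth, and
-- each step of the algorithm attains this bound.
-- Bruhat path: ℓ_S is the number of inversions, so every step must exchange values a < b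
-- with a to the left of b. The invariant that carries the induction is that the value a,
-- which moves right, satisfies a < w⁻¹(a). When u(w) starts with t_{w(n),n}, this keeps the
-- value w(n) > w⁻¹(n), the only one whose order that factor disturbs, from moving right.
{-# OPTIONS --safe #-}
module Submission where

open import Data.Bool.Base using (if_then_else_)
open import Data.Nat.Base as ℕ using (ℕ; zero; suc; _∸_; z≤n; s≤s)
open import Data.Nat.ListAction using (sum)
open import Data.Nat.ListAction.Properties using (sum-++)
import Data.Nat.Properties as ℕ
open import Algebra.Properties.CommutativeMonoid.Sum ℕ.+-0-commutativeMonoid
  using ( sum-syntax; sum-cong-≗; sum-replicate-zero; sum-remove; sum-permute
        ; ∑-distrib-+; sum-init-last)
open import Data.Fin.Base using (Fin; zero; suc; toℕ; fromℕ; inject₁; punchIn; _<_; _≤_)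
open import Data.Fin.Induction using (<-weakInduction; >-weakInduction)
open import Data.Fin.Permutation
  using ( Permutation′; _⟨$⟩ʳ_; _⟨$⟩ˡ_; _≈_; id; transpose; remove
        ; inverseʳ; inverseˡ; punchIn-permute)
import Data.Fin.Permutation.Components as PC
open import Data.Fin.Properties
  using ( _≟_; _≤?_; _<?_; any?; toℕ-inject₁; inject₁-injective; fromℕ≢inject₁; ≤fromℕ
        ; ≤-antisym; ≤∧≢⇒<; <-cmp; <⇒≢; punchInᵢ≢i)
open import Data.Fin.Relation.Unary.Top using (view; ‵fromℕ; ‵inject₁)
open import Data.List.Base using ([]; _∷_; [_]; _++_; map; length; filter; tabulate; inits)
open import Data.List.Properties using (map-++; map-∘; ++-assoc; length-++; length-map)
open import Data.List.Relation.Unary.All using (All; []; _∷_)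
open import Data.List.Relation.Unary.All.Properties using (++⁺)
open import Data.List.Relation.Unary.Linked using (Linked; [-]; _∷_)
open import Data.Product.Base using (∃-syntax; _×_; _,_; proj₁; proj₂)
open import Function.Base using (_∘_)
open import Function.Definitions using (Injective)
open import Relation.Binary.Definitions using (tri<; tri≈; tri>)
open import Relation.Binary.PropositionalEquality
  using (_≡_; _≢_; refl; sym; trans; cong; cong₂; subst; subst₂; ≢-sym; module ≡-Reasoning)
open import Relation.Nullary using (Dec; does; yes; no; ¬_; contradiction)
open import Relation.Nullary.Decidable using (dec-true; dec-false; _×-dec_)
open import Defs

private variable
  m n : ℕ

-- Transpositions as functions on points

τ : Fin n → Fin n → Fin n → Fin n
τ = PC.transpose

-- Matching on the view together with `τ i j k` replaces the value in each case. The points `i` and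
-- `j` may coincide, and then the overlap belongs to `at-left`.
data TransposeView {n} (i j k : Fin n) : Fin n → Set where
  at-left   : k ≡ i → TransposeView i j k j
  at-right  : k ≢ i → k ≡ j → TransposeView i j k i
  elsewhere : k ≢ i → k ≢ j → TransposeView i j k k

τ-view : (i j k : Fin n) → TransposeView i j k (τ i j k)
τ-view i j k with k ≟ i
... | yes k≡i = at-left k≡i
... | no  k≢i with k ≟ j
...   | yes k≡j = at-right k≢i k≡j
...   | no  k≢j = elsewhere k≢i k≢j

τ-left : (i j : Fin n) → τ i j i ≡ j
τ-left i j rewrite dec-true (i ≟ i) refl = refl

τ-right : (i j : Fin n) → τ i j j ≡ i
τ-right i j with τ i j j | τ-view i j j
... | _ | at-left j≡i       = j≡i
... | _ | at-right _ _      = refl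
... | _ | elsewhere _ j≢j   = contradiction refl j≢j

τ-other : {i j k : Fin n} → k ≢ i → k ≢ j → τ i j k ≡ k
τ-other {i = i} {j} {k} k≢i k≢j
  rewrite dec-false (k ≟ i) k≢i | dec-false (k ≟ j) k≢j = refl

τ-comm : (i j k : Fin n) → τ i j k ≡ τ j i k
τ-comm i j k with τ i j k | τ-view i j k
... | _ | at-left refl        = sym (τ-right j k)
... | _ | at-right _ refl     = sym (τ-left k i)
... | _ | elsewhere k≢i k≢j   = sym (τ-other k≢j k≢i)

τ-involutive : (i j k : Fin n) → τ i j (τ i j k) ≡ k
τ-involutive i j k = trans (cong (τ i j) (τ-comm i j k)) (PC.transpose-inverse i j)

τ-refl : (i k : Fin n) → τ i i k ≡ k
τ-refl i k with τ i i k | τ-view i i k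
... | _ | at-left k≡i     = sym k≡i
... | _ | at-right _ k≡i  = sym k≡i
... | _ | elsewhere _ _   = refl

-- The conjugation rule for transpositions. Taking any injection for `f` covers both permutations
-- and the embedding `inject₁`.
τ-conjugate : (f : Fin m → Fin n) → Injective _≡_ _≡_ f →
              ∀ i j k → f (τ i j k) ≡ τ (f i) (f j) (f k)
τ-conjugate f f-inj i j k with τ i j k | τ-view i j k
... | _ | at-left refl      = sym (τ-left (f k) (f j))
... | _ | at-right _ refl   = sym (τ-right (f i) (f k))
... | _ | elsewhere k≢i k≢j = sym (τ-other (k≢i ∘ f-inj) (k≢j ∘ f-inj))

⟨$⟩ʳ-injective : (w : Permutation′ n) → Injective _≡_ _≡_ (w ⟨$⟩ʳ_)
⟨$⟩ʳ-injective w eq = trans (sym (inverseˡ w)) (trans (cong (w ⟨$⟩ˡ_) eq) (inverseˡ w))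

-- Restriction of permutations that fix the largest point

punchIn-fromℕ : (i : Fin n) → punchIn (fromℕ n) i ≡ inject₁ i
punchIn-fromℕ zero    = refl
punchIn-fromℕ (suc i) = cong suc (punchIn-fromℕ i)

FixesLast : Permutation′ (suc n) → Set
FixesLast {n} w = w ⟨$⟩ʳ fromℕ n ≡ fromℕ n

inject₁-remove : (w : Permutation′ (suc n)) → FixesLast w →
                 ∀ i → w ⟨$⟩ʳ inject₁ i ≡ inject₁ (remove (fromℕ n) w ⟨$⟩ʳ i)
inject₁-remove {n} w fix i = begin
  w ⟨$⟩ʳ inject₁ i                     ≡⟨ cong (w ⟨$⟩ʳ_) (sym (punchIn-fromℕ i)) ⟩
  w ⟨$⟩ʳ punchIn (fromℕ n) i           ≡⟨ punchIn-permute w (fromℕ n) i ⟩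
  punchIn (w ⟨$⟩ʳ fromℕ n) (w′ ⟨$⟩ʳ i) ≡⟨ cong (λ l → punchIn l (w′ ⟨$⟩ʳ i)) fix ⟩
  punchIn (fromℕ n) (w′ ⟨$⟩ʳ i)        ≡⟨ punchIn-fromℕ (w′ ⟨$⟩ʳ i) ⟩
  inject₁ (w′ ⟨$⟩ʳ i)                  ∎
  where
  open ≡-Reasoning
  w′ = remove (fromℕ n) w

-- Induction along the algorithm

data DecompView {n} (w : Permutation′ (2 ℕ.+ n)) : Word (2 ℕ.+ n) × Word (2 ℕ.+ n) → Set where
  fixed : FixesLast w → DecompView w (decompRestriction n w)
  right : (wn≢n : w ⟨$⟩ʳ fromℕ (suc n) ≢ fromℕ (suc n)) →
          w ⟨$⟩ʳ fromℕ (suc n) ≤ w ⟨$⟩ˡ fromℕ (suc n) →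
          DecompView w
            (let t     = t-last (w ⟨$⟩ʳ fromℕ (suc n)) wn≢n
                 t′    = t-last (w ⟨$⟩ˡ fromℕ (suc n)) (from-last-≢ w wn≢n)
                 u , v = decompRestriction n (⟦ t ⟧ · w)
             in  u , v ++ [ t′ ])
  left  : (wn≢n : w ⟨$⟩ʳ fromℕ (suc n) ≢ fromℕ (suc n)) →
          w ⟨$⟩ˡ fromℕ (suc n) < w ⟨$⟩ʳ fromℕ (suc n) →
          DecompView w
            (let t     = t-last (w ⟨$⟩ʳ fromℕ (suc n)) wn≢n
                 u , v = decompRestriction n (⟦ t ⟧ · w)
             in  t ∷ u , v)

-- The nested case distinction of `shallowDecomp` is resolved once here, so that later proofs only
-- match on its three outcomes.
decompView : (w : Permutation′ (2 ℕ.+ n)) → DecompView w (shallowDecomp (suc n) w)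
decompView {n} w with w ⟨$⟩ʳ fromℕ (suc n) ≟ fromℕ (suc n)
... | yes fix  = fixed fix
... | no  wn≢n with w ⟨$⟩ʳ fromℕ (suc n) ≤? w ⟨$⟩ˡ fromℕ (suc n)
...   | yes q≤p = right wn≢n q≤p
...   | no  q≰p = left wn≢n (ℕ.≰⇒> q≰p)

output : Permutation′ (suc n) → Word (suc n)
output w = let u , v = shallowDecomp _ w in u ++ v

-- The motive sees only the concatenation uv: case (a) appends one letter to it, case (b) prepends
-- one, and the three inductions below work with a single word.
module _
  (P : ∀ {n} → Permutation′ (suc n) → Word (suc n) → Set)
  (baseP : (w : Permutation′ 1) → P w [])
  (fixedP : ∀ {n} (w : Permutation′ (2 ℕ.+ n)) ts → FixesLast w →
           P (remove (fromℕ (suc n)) w) ts → P w (extend ts))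
  (rightP : ∀ {n} (w : Permutation′ (2 ℕ.+ n)) ts wn≢n →
           w ⟨$⟩ʳ fromℕ (suc n) ≤ w ⟨$⟩ˡ fromℕ (suc n) →
           P (remove (fromℕ (suc n)) (⟦ t-last (w ⟨$⟩ʳ fromℕ (suc n)) wn≢n ⟧ · w)) ts →
           P w (extend ts ++ [ t-last (w ⟨$⟩ˡ fromℕ (suc n)) (from-last-≢ w wn≢n) ]))
  (leftP : ∀ {n} (w : Permutation′ (2 ℕ.+ n)) ts wn≢n →
          w ⟨$⟩ˡ fromℕ (suc n) < w ⟨$⟩ʳ fromℕ (suc n) →
          P (remove (fromℕ (suc n)) (⟦ t-last (w ⟨$⟩ʳ fromℕ (suc n)) wn≢n ⟧ · w)) ts →
          P w (t-last (w ⟨$⟩ʳ fromℕ (suc n)) wn≢n ∷ extend ts))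
  where

  private
    right′ : ∀ {n} (w : Permutation′ (2 ℕ.+ n)) u v wn≢n →
             w ⟨$⟩ʳ fromℕ (suc n) ≤ w ⟨$⟩ˡ fromℕ (suc n) →
             P (remove (fromℕ (suc n)) (⟦ t-last (w ⟨$⟩ʳ fromℕ (suc n)) wn≢n ⟧ · w)) (u ++ v) →
             P w (extend u ++ (extend v ++ [ t-last (w ⟨$⟩ˡ fromℕ (suc n)) (from-last-≢ w wn≢n) ]))
    -- The algorithm appends t′ to v, so (uv)t′ is reassociated to u(vt′).
    right′ {n} w u v wn≢n q≤p p = subst (P w)
      (trans (cong (_++ [ t ]) (map-++ extendₜ u v)) (++-assoc (extend u) (extend v) [ t ]))
      (rightP w (u ++ v) wn≢n q≤p p)
      where t = t-last (w ⟨$⟩ˡ fromℕ (suc n)) (from-last-≢ w wn≢n)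

  output-elim : ∀ n (w : Permutation′ (suc n)) → P w (output w)
  private
    -- Keeping the pair `uv` a variable index lets a match on the view determine it.
    cases : ∀ {n} (w : Permutation′ (2 ℕ.+ n)) {uv} → DecompView w uv →
            P w (proj₁ uv ++ proj₂ uv)
  output-elim zero    w = baseP w
  output-elim (suc n) w = cases w (decompView w)
  cases {n} w (fixed fix) =
      let u , v = shallowDecomp n (remove (fromℕ (suc n)) w) in
      subst (P w) (map-++ extendₜ u v)
        (fixedP w (u ++ v) fix (output-elim n (remove (fromℕ (suc n)) w)))
  cases {n} w (right wn≢n q≤p) =
      let t     = t-last (w ⟨$⟩ʳ fromℕ (suc n)) wn≢n
          u , v = shallowDecomp n (remove (fromℕ (suc n)) (⟦ t ⟧ · w))
      in right′ w u v wn≢n q≤p (output-elim n (remove (fromℕ (suc n)) (⟦ t ⟧ · w)))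
  cases {n} w (left wn≢n p<q) =
      let t     = t-last (w ⟨$⟩ʳ fromℕ (suc n)) wn≢n
          u , v = shallowDecomp n (remove (fromℕ (suc n)) (⟦ t ⟧ · w))
      in subst (P w) (cong (t ∷_) (map-++ extendₜ u v))
        (leftP w (u ++ v) wn≢n p<q (output-elim n (remove (fromℕ (suc n)) (⟦ t ⟧ · w))))

-- Products of the output words

∏-extend-inject₁ : (ts : Word n) → ∀ i → ∏ (extend ts) ⟨$⟩ʳ inject₁ i ≡ inject₁ (∏ ts ⟨$⟩ʳ i)
∏-extend-inject₁ []       i = refl
∏-extend-inject₁ (t ∷ ts) i = trans
  (cong (⟦ extendₜ t ⟧ ⟨$⟩ʳ_) (∏-extend-inject₁ ts i))
  (sym (τ-conjugate inject₁ inject₁-injective (lo t) (hi t) (∏ ts ⟨$⟩ʳ i)))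

∏-extend-last : (ts : Word n) → FixesLast (∏ (extend ts))
∏-extend-last []       = refl
∏-extend-last (t ∷ ts) = trans
  (cong (⟦ extendₜ t ⟧ ⟨$⟩ʳ_) (∏-extend-last ts))
  (τ-other fromℕ≢inject₁ fromℕ≢inject₁)

∏-extend : (w : Permutation′ (suc n)) → FixesLast w → (ts : Word n) →
           ∏ ts ≈ remove (fromℕ n) w → ∏ (extend ts) ≈ w
∏-extend w fix ts eq i with view i
... | ‵fromℕ     = trans (∏-extend-last ts) (sym fix)
... | ‵inject₁ j = trans (∏-extend-inject₁ ts j)
                     (trans (cong inject₁ (eq j)) (sym (inject₁-remove w fix j)))

∏-++ : (ss ts : Word n) → ∏ (ss ++ ts) ≈ ∏ ss · ∏ ts
∏-++ []       ts i = refl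
∏-++ (s ∷ ss) ts i = cong (⟦ s ⟧ ⟨$⟩ʳ_) (∏-++ ss ts i)

-- This is why case (a) may append a factor, although w′ is defined by multiplying on the left.
τ-last-swap : (w : Permutation′ (suc n)) → ∀ i →
              τ (w ⟨$⟩ʳ fromℕ n) (fromℕ n) (w ⟨$⟩ʳ i) ≡ w ⟨$⟩ʳ τ (w ⟨$⟩ˡ fromℕ n) (fromℕ n) i
τ-last-swap {n} w i = sym (begin
  w ⟨$⟩ʳ τ (w ⟨$⟩ˡ fromℕ n) (fromℕ n) i
    ≡⟨ τ-conjugate (w ⟨$⟩ʳ_) (⟨$⟩ʳ-injective w) _ _ i ⟩
  τ (w ⟨$⟩ʳ (w ⟨$⟩ˡ fromℕ n)) (w ⟨$⟩ʳ fromℕ n) (w ⟨$⟩ʳ i)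
    ≡⟨ cong (λ l → τ l (w ⟨$⟩ʳ fromℕ n) (w ⟨$⟩ʳ i)) (inverseʳ w) ⟩
  τ (fromℕ n) (w ⟨$⟩ʳ fromℕ n) (w ⟨$⟩ʳ i)
    ≡⟨ τ-comm _ _ (w ⟨$⟩ʳ i) ⟩
  τ (w ⟨$⟩ʳ fromℕ n) (fromℕ n) (w ⟨$⟩ʳ i) ∎)
  where open ≡-Reasoning

-- By `τ-last-swap`, w′ = t·w = w·t′, and t′ is an involution, so w = w′·t′.
∏-extend-snoc : (w : Permutation′ (suc n)) (wn≢n : w ⟨$⟩ʳ fromℕ n ≢ fromℕ n) (ts : Word n) →
                ∏ ts ≈ remove (fromℕ n) (⟦ t-last (w ⟨$⟩ʳ fromℕ n) wn≢n ⟧ · w) →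
                ∏ (extend ts ++ [ t-last (w ⟨$⟩ˡ fromℕ n) (from-last-≢ w wn≢n) ]) ≈ w
∏-extend-snoc {n} w wn≢n ts eq i = begin
  ∏ (extend ts ++ [ t′ ]) ⟨$⟩ʳ i        ≡⟨ ∏-++ (extend ts) [ t′ ] i ⟩
  ∏ (extend ts) ⟨$⟩ʳ (⟦ t′ ⟧ ⟨$⟩ʳ i)    ≡⟨ ∏-extend (⟦ t ⟧ · w) (τ-left (lo t) (hi t)) ts eq (⟦ t′ ⟧ ⟨$⟩ʳ i) ⟩
  ⟦ t ⟧ · w ⟨$⟩ʳ (⟦ t′ ⟧ ⟨$⟩ʳ i)        ≡⟨ τ-last-swap w (⟦ t′ ⟧ ⟨$⟩ʳ i) ⟩
  w · ⟦ t′ ⟧ ⟨$⟩ʳ (⟦ t′ ⟧ ⟨$⟩ʳ i)       ≡⟨ cong (w ⟨$⟩ʳ_) (τ-involutive (lo t′) (hi t′) i) ⟩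
  w ⟨$⟩ʳ i                              ∎
  where
  open ≡-Reasoning
  t  = t-last (w ⟨$⟩ʳ fromℕ n) wn≢n
  t′ = t-last (w ⟨$⟩ˡ fromℕ n) (from-last-≢ w wn≢n)

∏-cons-extend : (w : Permutation′ (suc n)) (wn≢n : w ⟨$⟩ʳ fromℕ n ≢ fromℕ n) (ts : Word n) →
                ∏ ts ≈ remove (fromℕ n) (⟦ t-last (w ⟨$⟩ʳ fromℕ n) wn≢n ⟧ · w) →
                ∏ (t-last (w ⟨$⟩ʳ fromℕ n) wn≢n ∷ extend ts) ≈ w
∏-cons-extend {n} w wn≢n ts eq i = trans
  (cong (⟦ t ⟧ ⟨$⟩ʳ_) (∏-extend (⟦ t ⟧ · w) (τ-left (lo t) (hi t)) ts eq i))
  (τ-involutive (lo t) (hi t) (w ⟨$⟩ʳ i))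
  where t = t-last (w ⟨$⟩ʳ fromℕ n) wn≢n

-- Reflection length

-- A `Transposition` stores its points in increasing order, whereas `contract` produces a pair whose
-- order is unknown.
transposition : (i j : Fin n) → i ≢ j → ∃[ t ] (∀ k → ⟦ t ⟧ ⟨$⟩ʳ k ≡ τ i j k)
transposition i j i≢j with <-cmp i j
... | tri< i<j _ _ = t⟨ i , j , i<j ⟩ , λ _ → refl
... | tri≈ _ i≡j _ = contradiction i≡j i≢j
... | tri> _ _ j<i = t⟨ j , i , j<i ⟩ , τ-comm j i

-- t_{w(n),n} · w is w with n deleted from its cycle.
Contraction : Word (suc n) → Word n → Set
Contraction {n} ss ss′ =
  ∀ i → inject₁ (∏ ss′ ⟨$⟩ʳ i) ≡ τ (∏ ss ⟨$⟩ʳ fromℕ n) (fromℕ n) (∏ ss ⟨$⟩ʳ inject₁ i)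

-- Let x be the product of the tail, p = x(n), and σ the first letter. If σ fixes n, it is kept, as
-- (σ(p) n)σx = σ(p n)x. A letter (a n) is dropped if p is n or a, and otherwise becomes (a p), as
-- (p n)(a n) = (a p)(p n). Strictness comes from a dropped letter: as long as none is dropped, the
-- product fixes n.
contract : (ss : Word (suc n)) → ∃[ ss′ ]
  ( Contraction ss ss′ × length ss′ ℕ.≤ length ss
  × (∏ ss ⟨$⟩ʳ fromℕ n ≢ fromℕ n → length ss′ ℕ.< length ss))
contract [] = [] , (λ i → sym (τ-refl _ _)) , z≤n , λ n≢n → contradiction refl n≢n
contract {n} (t⟨ a , b , a<b ⟩ ∷ ss) with contract ss | view a | view b
... | _ | ‵fromℕ | _ = contradiction (≤fromℕ b) (ℕ.<⇒≱ a<b)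
... | ss′ , con , ≤ss , <ss | ‵inject₁ a | ‵inject₁ b =
  t ∷ ss′ , contraction , s≤s ≤ss ,
  -- The first letter fixes n, so if the whole product moves n, the tail already does.
  λ q≢n → s≤s (<ss λ p≡n → q≢n (trans (cong (τ (inject₁ a) (inject₁ b)) p≡n) t-last≡last))
  where
  t : Transposition n
  t = t⟨ a , b , subst₂ ℕ._<_ (toℕ-inject₁ a) (toℕ-inject₁ b) a<b ⟩
  p = ∏ ss ⟨$⟩ʳ fromℕ n
  t-last≡last : τ (inject₁ a) (inject₁ b) (fromℕ n) ≡ fromℕ n
  t-last≡last = τ-other fromℕ≢inject₁ fromℕ≢inject₁
  contraction : Contraction (t⟨ inject₁ a , inject₁ b , a<b ⟩ ∷ ss) (t ∷ ss′)
  contraction i = begin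
    inject₁ (τ a b (∏ ss′ ⟨$⟩ʳ i))
      ≡⟨ τ-conjugate inject₁ inject₁-injective a b (∏ ss′ ⟨$⟩ʳ i) ⟩
    τ (inject₁ a) (inject₁ b) (inject₁ (∏ ss′ ⟨$⟩ʳ i))
      ≡⟨ cong (τ (inject₁ a) (inject₁ b)) (con i) ⟩
    σ (τ p (fromℕ n) v)
      ≡⟨ τ-conjugate σ (⟨$⟩ʳ-injective (transpose (inject₁ a) (inject₁ b))) p (fromℕ n) v ⟩
    τ (σ p) (σ (fromℕ n)) (σ v)
      ≡⟨ cong (λ l → τ (σ p) l (σ v)) t-last≡last ⟩
    τ (σ p) (fromℕ n) (σ v) ∎
    where
    open ≡-Reasoning
    σ = τ (inject₁ a) (inject₁ b)
    v = ∏ ss ⟨$⟩ʳ inject₁ i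
... | ss′ , con , ≤ss , <ss | ‵inject₁ a | ‵fromℕ
  with ∏ ss ⟨$⟩ʳ fromℕ n | view (∏ ss ⟨$⟩ʳ fromℕ n)
-- The new product sends n to a, so its contraction multiplies by (a n) again and cancels the
-- letter.
... | .(fromℕ n) | ‵fromℕ = ss′ , contraction , ℕ.m≤n⇒m≤1+n ≤ss , λ _ → s≤s ≤ss
  where
  contraction : ∀ i → inject₁ (∏ ss′ ⟨$⟩ʳ i) ≡
    τ (τ (inject₁ a) (fromℕ n) (fromℕ n)) (fromℕ n) (τ (inject₁ a) (fromℕ n) (∏ ss ⟨$⟩ʳ inject₁ i))
  contraction i = trans (con i) (trans (τ-refl (fromℕ n) _) (sym (trans
    (cong (λ l → τ l (fromℕ n) (τ (inject₁ a) (fromℕ n) (∏ ss ⟨$⟩ʳ inject₁ i))) (τ-right (inject₁ a) (fromℕ n)))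
    (τ-involutive (inject₁ a) (fromℕ n) (∏ ss ⟨$⟩ʳ inject₁ i)))))
... | .(inject₁ p) | ‵inject₁ p with p ≟ a
-- The letter sends p back to n, so the new product is its own contraction, and the letter is the
-- factor by which the tail is contracted.
...   | yes refl = ss′ , contraction , ℕ.m≤n⇒m≤1+n ≤ss , λ _ → s≤s ≤ss
  where
  contraction : ∀ i → inject₁ (∏ ss′ ⟨$⟩ʳ i) ≡
    τ (τ (inject₁ p) (fromℕ n) (inject₁ p)) (fromℕ n) (τ (inject₁ p) (fromℕ n) (∏ ss ⟨$⟩ʳ inject₁ i))
  contraction i = trans (con i) (sym (trans
    (cong (λ l → τ l (fromℕ n) (τ (inject₁ p) (fromℕ n) (∏ ss ⟨$⟩ʳ inject₁ i))) (τ-left (inject₁ p) (fromℕ n)))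
    (τ-refl (fromℕ n) _)))
...   | no p≢a with transposition a p (≢-sym p≢a)
...     | t , t≡ = t ∷ ss′ , contraction , s≤s ≤ss , λ _ → s≤s (<ss (≢-sym fromℕ≢inject₁))
  where
  τan-p : τ (inject₁ a) (fromℕ n) (inject₁ p) ≡ inject₁ p
  τan-p = τ-other (p≢a ∘ inject₁-injective) (≢-sym fromℕ≢inject₁)
  contraction : ∀ i → inject₁ (⟦ t ⟧ ⟨$⟩ʳ (∏ ss′ ⟨$⟩ʳ i)) ≡
    τ (τ (inject₁ a) (fromℕ n) (inject₁ p)) (fromℕ n) (τ (inject₁ a) (fromℕ n) (∏ ss ⟨$⟩ʳ inject₁ i))
  contraction i = begin
    inject₁ (⟦ t ⟧ ⟨$⟩ʳ (∏ ss′ ⟨$⟩ʳ i))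
      ≡⟨ cong inject₁ (t≡ (∏ ss′ ⟨$⟩ʳ i)) ⟩
    inject₁ (τ a p (∏ ss′ ⟨$⟩ʳ i))
      ≡⟨ τ-conjugate inject₁ inject₁-injective a p (∏ ss′ ⟨$⟩ʳ i) ⟩
    τ (inject₁ a) (inject₁ p) (inject₁ (∏ ss′ ⟨$⟩ʳ i))
      ≡⟨ cong (τ (inject₁ a) (inject₁ p)) (con i) ⟩
    τ (inject₁ a) (inject₁ p) (τ (inject₁ p) (fromℕ n) v)
      ≡⟨ cong₂ (λ k l → τ k l (τ (inject₁ p) (fromℕ n) v))
           (sym (τ-other (p≢a ∘ inject₁-injective ∘ sym) (≢-sym fromℕ≢inject₁)))
           (sym (τ-right (inject₁ p) (fromℕ n))) ⟩
    τ (τ (inject₁ p) (fromℕ n) (inject₁ a)) (τ (inject₁ p) (fromℕ n) (fromℕ n)) (τ (inject₁ p) (fromℕ n) v)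
      ≡⟨ τ-conjugate (τ (inject₁ p) (fromℕ n)) (⟨$⟩ʳ-injective (transpose (inject₁ p) (fromℕ n)))
           (inject₁ a) (fromℕ n) v ⟨
    τ (inject₁ p) (fromℕ n) (τ (inject₁ a) (fromℕ n) v)
      ≡⟨ cong (λ l → τ l (fromℕ n) (τ (inject₁ a) (fromℕ n) v)) (sym τan-p) ⟩
    τ (τ (inject₁ a) (fromℕ n) (inject₁ p)) (fromℕ n) (τ (inject₁ a) (fromℕ n) v) ∎
    where
    open ≡-Reasoning
    v = ∏ ss ⟨$⟩ʳ inject₁ i

length-extend : (ts : Word n) → length (extend ts) ≡ length ts
length-extend = length-map extendₜ

output-shortest : ∀ n (w : Permutation′ (suc n)) ss → ∏ ss ≈ w → length (output w) ℕ.≤ length ss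
output-shortest = output-elim (λ w ts → ∀ ss → ∏ ss ≈ w → length ts ℕ.≤ length ss)
  (λ _ _ _ → z≤n)
  (λ {n} w ts fix shortest ss eq →
    let ss′ , con , ≤ss , _ = contract ss
    in ℕ.≤-trans (ℕ.≤-reflexive (length-extend ts)) (ℕ.≤-trans (shortest ss′ λ i → inject₁-injective
         (trans (con i) (trans (cong₂ (λ p v → τ p (fromℕ (suc n)) v)
                                 (trans (eq (fromℕ (suc n))) fix) (eq (inject₁ i)))
           (trans (τ-refl (fromℕ (suc n)) (w ⟨$⟩ʳ inject₁ i)) (inject₁-remove w fix i)))))
         ≤ss))
  (λ {n} w ts wn≢n _ shortest ss eq →
    let t′ = t-last (w ⟨$⟩ˡ fromℕ (suc n)) (from-last-≢ w wn≢n)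
    in subst (ℕ._≤ length ss) (sym (trans (length-++ (extend ts)) (ℕ.+-comm _ 1)))
         (moved w ts wn≢n shortest ss eq))
  (λ w ts wn≢n _ → moved w ts wn≢n)
  where
  -- Cases (a) and (b) both add one letter to the recursive output, and contraction takes at least
  -- one letter from any competing word, whose product moves n.
  moved : ∀ {n} (w : Permutation′ (2 ℕ.+ n)) (ts : Word (suc n)) wn≢n →
    (∀ ss → ∏ ss ≈ remove (fromℕ (suc n)) (⟦ t-last (w ⟨$⟩ʳ fromℕ (suc n)) wn≢n ⟧ · w) →
            length ts ℕ.≤ length ss) →
    ∀ ss → ∏ ss ≈ w → length (extend ts) ℕ.< length ss
  moved {n} w ts wn≢n shortest ss eq =
    let ss′ , con , _ , <ss = contract ss
        t = t-last (w ⟨$⟩ʳ fromℕ (suc n)) wn≢n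
    in ℕ.≤-<-trans (ℕ.≤-reflexive (length-extend ts)) (ℕ.≤-<-trans (shortest ss′ λ i → inject₁-injective
         (trans (con i) (trans (cong₂ (λ p v → τ p (fromℕ (suc n)) v) (eq (fromℕ (suc n))) (eq (inject₁ i)))
           (inject₁-remove (⟦ t ⟧ · w) (τ-left (lo t) (hi t)) i))))
         (<ss (λ fix → wn≢n (trans (sym (eq (fromℕ (suc n)))) fix))))

-- Depth

sum-mono : {f g : Fin n → ℕ} → (∀ i → f i ℕ.≤ g i) → ∑[ i < n ] f i ℕ.≤ ∑[ i < n ] g i
sum-mono {zero}  f≤g = z≤n
sum-mono {suc n} f≤g = ℕ.+-mono-≤ (f≤g zero) (sum-mono (f≤g ∘ suc))

sum-zero : {f : Fin n → ℕ} → (∀ i → f i ≡ 0) → ∑[ i < n ] f i ≡ 0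
sum-zero {n} f≡0 = trans (sum-cong-≗ f≡0) (sum-replicate-zero n)

sum-single : {f : Fin n → ℕ} (k : Fin n) → (∀ i → i ≢ k → f i ≡ 0) → ∑[ i < n ] f i ≡ f k
sum-single {suc n} {f} k f≡0 = begin
  ∑[ i < suc n ] f i                ≡⟨ sum-remove {i = k} f ⟩
  f k ℕ.+ ∑[ i < n ] f (punchIn k i) ≡⟨ cong (f k ℕ.+_) (sum-zero (λ i → f≡0 _ (punchInᵢ≢i k i))) ⟩
  f k ℕ.+ 0                         ≡⟨ ℕ.+-identityʳ (f k) ⟩
  f k                               ∎
  where open ≡-Reasoning

-- A point mass: a change at one index is added as a function, so that pointwise identities can be
-- summed.
infix 9 _at_
_at_ : ℕ → Fin n → Fin n → ℕ
(c at k) i = if does (i ≟ k) then c else 0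

at-same : ∀ c (k : Fin n) → (c at k) k ≡ c
at-same c k rewrite dec-true (k ≟ k) refl = refl

at-other : ∀ {c} {i k : Fin n} → i ≢ k → (c at k) i ≡ 0
at-other {i = i} {k} i≢k rewrite dec-false (i ≟ k) i≢k = refl

sum-at : ∀ c (k : Fin n) → ∑[ i < n ] (c at k) i ≡ c
sum-at c k = trans (sum-single {f = c at k} k (λ _ → at-other)) (at-same c k)

-- Σ_{w(i) > i} (w(i) - i): by truncation the other indices contribute 0.
excess : Permutation′ n → ℕ
excess {n} w = ∑[ i < n ] (toℕ (w ⟨$⟩ʳ i) ∸ toℕ i)

excess-cong : (x y : Permutation′ n) → x ≈ y → excess x ≡ excess y
excess-cong x y x≈y = sum-cong-≗ (λ i → cong (λ l → toℕ l ∸ toℕ i) (x≈y i))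

sum-map-filter : {A : Set} {P : A → Set} (P? : ∀ x → Dec (P x)) (g : A → ℕ) →
                 (∀ x → ¬ P x → g x ≡ 0) → ∀ xs → sum (map g (filter P? xs)) ≡ sum (map g xs)
sum-map-filter P? g g≡0 []       = refl
sum-map-filter P? g g≡0 (x ∷ xs) with P? x
... | yes _  = cong (g x ℕ.+_) (sum-map-filter P? g g≡0 xs)
... | no ¬px = trans (sum-map-filter P? g g≡0 xs) (cong (ℕ._+ sum (map g xs)) (sym (g≡0 x ¬px)))

sum-map-tabulate : {A : Set} (g : A → ℕ) (f : Fin n → A) →
                   sum (map g (tabulate f)) ≡ ∑[ i < n ] g (f i)
sum-map-tabulate {zero}  g f = refl
sum-map-tabulate {suc n} g f = cong (g (f zero) ℕ.+_) (sum-map-tabulate g (f ∘ suc))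

excedanceSum≡excess : (w : Permutation′ n) → excedanceSum w ≡ excess w
excedanceSum≡excess {n} w = trans
  (sum-map-filter (λ i → i <? w ⟨$⟩ʳ i) (λ i → toℕ (w ⟨$⟩ʳ i) ∸ toℕ i)
    (λ i i≮w → ℕ.m≤n⇒m∸n≡0 (ℕ.≮⇒≥ i≮w)) (tabulate (λ i → i)))
  (sum-map-tabulate (λ i → toℕ (w ⟨$⟩ʳ i) ∸ toℕ i) (λ i → i))

∸-triangle : ∀ a b c → a ∸ c ℕ.≤ (b ∸ c) ℕ.+ (a ∸ b)
∸-triangle a b c = ℕ.m≤n+o⇒m∸n≤o a c (begin
  a                           ≤⟨ ℕ.m≤n+m∸n a b ⟩
  b ℕ.+ (a ∸ b)               ≤⟨ ℕ.+-monoˡ-≤ (a ∸ b) (ℕ.m≤n+m∸n b c) ⟩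
  c ℕ.+ (b ∸ c) ℕ.+ (a ∸ b)   ≡⟨ ℕ.+-assoc c _ _ ⟩
  c ℕ.+ ((b ∸ c) ℕ.+ (a ∸ b)) ∎)
  where open ℕ.≤-Reasoning

∸-split : ∀ {a b c} → c ℕ.≤ b → b ℕ.≤ a → a ∸ c ≡ (b ∸ c) ℕ.+ (a ∸ b)
∸-split {a} {b} {c} c≤b b≤a = begin
  a ∸ c                   ≡⟨ cong (_∸ c) (sym (ℕ.m+[n∸m]≡n b≤a)) ⟩
  b ℕ.+ (a ∸ b) ∸ c       ≡⟨ ℕ.+-∸-comm (a ∸ b) c≤b ⟩
  (b ∸ c) ℕ.+ (a ∸ b)     ∎
  where open ≡-Reasoning

-- Only the position with value `lo t` receives a larger value, and its summand grows by at most the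
-- depth of `t`.
excess-transposition-· : (t : Transposition n) (w : Permutation′ n) →
                         excess (⟦ t ⟧ · w) ℕ.≤ depthₜ t ℕ.+ excess w
excess-transposition-· {n} t w = begin
  excess (⟦ t ⟧ · w)
    ≤⟨ sum-mono pointwise ⟩
  ∑[ i < n ] ((depthₜ t at lo t) (w ⟨$⟩ʳ i) ℕ.+ (toℕ (w ⟨$⟩ʳ i) ∸ toℕ i))
    ≡⟨ ∑-distrib-+ (λ i → (depthₜ t at lo t) (w ⟨$⟩ʳ i)) (λ i → toℕ (w ⟨$⟩ʳ i) ∸ toℕ i) ⟩
  ∑[ i < n ] (depthₜ t at lo t) (w ⟨$⟩ʳ i) ℕ.+ excess w
    -- The point mass sits at a value; reindexing by `w` turns the sum over positions into one over
    -- values.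
    ≡⟨ cong (ℕ._+ excess w) (trans (sym (sum-permute (depthₜ t at lo t) w)) (sum-at (depthₜ t) (lo t))) ⟩
  depthₜ t ℕ.+ excess w ∎
  where
  open ℕ.≤-Reasoning
  move : ∀ v i → toℕ (τ (lo t) (hi t) v) ∸ i ℕ.≤ (depthₜ t at lo t) v ℕ.+ (toℕ v ∸ i)
  move v i with τ (lo t) (hi t) v | τ-view (lo t) (hi t) v
  ... | _ | at-left refl rewrite at-same (depthₜ t) (lo t) =
    ℕ.≤-trans (∸-triangle (toℕ (hi t)) (toℕ (lo t)) i) (ℕ.≤-reflexive (ℕ.+-comm _ (depthₜ t)))
  ... | _ | at-right _ refl =
    ℕ.≤-trans (ℕ.∸-monoˡ-≤ i (ℕ.<⇒≤ (lo<hi t))) (ℕ.m≤n+m _ _)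
  ... | _ | elsewhere _ _ = ℕ.m≤n+m _ _
  pointwise : ∀ i → toℕ (⟦ t ⟧ · w ⟨$⟩ʳ i) ∸ toℕ i ℕ.≤
                    (depthₜ t at lo t) (w ⟨$⟩ʳ i) ℕ.+ (toℕ (w ⟨$⟩ʳ i) ∸ toℕ i)
  pointwise i = move (w ⟨$⟩ʳ i) (toℕ i)

excess-∏≤depth : (ts : Word n) → excess (∏ ts) ℕ.≤ depth ts
excess-∏≤depth {n} []       = ℕ.≤-reflexive (sum-zero {n} (λ i → ℕ.n∸n≡0 (toℕ i)))
excess-∏≤depth     (t ∷ ts) = ℕ.≤-trans (excess-transposition-· t (∏ ts))
                                (ℕ.+-monoʳ-≤ (depthₜ t) (excess-∏≤depth ts))

excess-remove : (w : Permutation′ (suc n)) → FixesLast w →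
                excess w ≡ excess (remove (fromℕ n) w)
excess-remove {n} w fix = begin
  excess w
    ≡⟨ sum-init-last (λ i → toℕ (w ⟨$⟩ʳ i) ∸ toℕ i) ⟩
  ∑[ i < n ] (toℕ (w ⟨$⟩ʳ inject₁ i) ∸ toℕ (inject₁ i)) ℕ.+ (toℕ (w ⟨$⟩ʳ fromℕ n) ∸ toℕ (fromℕ n))
    ≡⟨ cong₂ ℕ._+_ (sum-cong-≗ restricted)
         (trans (cong (λ l → toℕ l ∸ toℕ (fromℕ n)) fix) (ℕ.n∸n≡0 (toℕ (fromℕ n)))) ⟩
  excess (remove (fromℕ n) w) ℕ.+ 0
    ≡⟨ ℕ.+-identityʳ _ ⟩
  excess (remove (fromℕ n) w) ∎
  where
  open ≡-Reasoning
  restricted : ∀ i → toℕ (w ⟨$⟩ʳ inject₁ i) ∸ toℕ (inject₁ i) ≡ toℕ (remove (fromℕ n) w ⟨$⟩ʳ i) ∸ toℕ i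
  restricted i = cong₂ _∸_ (trans (cong toℕ (inject₁-remove w fix i)) (toℕ-inject₁ _)) (toℕ-inject₁ i)

-- Passing from w to t·w changes the summand only at p = w⁻¹(n), where the value n becomes q = w(n);
-- at position n both summands vanish. The loss `c` at p is a parameter because cases (a) and (b)
-- compute it differently.
excess-moved : (w : Permutation′ (suc n)) (wn≢n : w ⟨$⟩ʳ fromℕ n ≢ fromℕ n) → ∀ c →
               toℕ (fromℕ n) ∸ toℕ (w ⟨$⟩ˡ fromℕ n) ≡
                 (toℕ (w ⟨$⟩ʳ fromℕ n) ∸ toℕ (w ⟨$⟩ˡ fromℕ n)) ℕ.+ c →
               excess w ≡ excess (remove (fromℕ n) (⟦ t-last (w ⟨$⟩ʳ fromℕ n) wn≢n ⟧ · w)) ℕ.+ c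
excess-moved {n} w wn≢n c cost = begin
  excess w
    ≡⟨ sum-cong-≗ pointwise ⟩
  ∑[ i < suc n ] ((toℕ (τ q l (w ⟨$⟩ʳ i)) ∸ toℕ i) ℕ.+ (c at p) i)
    ≡⟨ ∑-distrib-+ (λ i → toℕ (τ q l (w ⟨$⟩ʳ i)) ∸ toℕ i) (c at p) ⟩
  excess (⟦ t ⟧ · w) ℕ.+ ∑[ i < suc n ] (c at p) i
    ≡⟨ cong₂ ℕ._+_ (excess-remove (⟦ t ⟧ · w) (τ-left q l)) (sum-at c p) ⟩
  excess (remove (fromℕ n) (⟦ t ⟧ · w)) ℕ.+ c ∎
  where
  open ≡-Reasoning
  t = t-last (w ⟨$⟩ʳ fromℕ n) wn≢n
  l = fromℕ n
  q = w ⟨$⟩ʳ l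
  p = w ⟨$⟩ˡ l
  pointwise : ∀ i → toℕ (w ⟨$⟩ʳ i) ∸ toℕ i ≡ (toℕ (τ q l (w ⟨$⟩ʳ i)) ∸ toℕ i) ℕ.+ (c at p) i
  pointwise i with i ≟ p
  ... | yes refl rewrite inverseʳ w {l} | τ-right q l = cost
  ... | no  i≢p with i ≟ l
  ...   | yes refl rewrite τ-left q l | ℕ.n∸n≡0 (toℕ l) = ℕ.m≤n⇒m∸n≡0 (≤fromℕ q)
  ...   | no  i≢l rewrite τ-other {i = q} {l} {w ⟨$⟩ʳ i} (i≢l ∘ ⟨$⟩ʳ-injective w)
                            (λ wi≡l → i≢p (trans (sym (inverseˡ w)) (cong (w ⟨$⟩ˡ_) wi≡l)))
            = sym (ℕ.+-identityʳ _)

depth-extend : (ts : Word n) → depth (extend ts) ≡ depth ts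
depth-extend []       = refl
depth-extend (t ∷ ts) = cong₂ ℕ._+_ (cong₂ _∸_ (toℕ-inject₁ (hi t)) (toℕ-inject₁ (lo t))) (depth-extend ts)

depth-++ : (ss ts : Word n) → depth (ss ++ ts) ≡ depth ss ℕ.+ depth ts
depth-++ ss ts = trans (cong sum (map-++ depthₜ ss ts)) (sum-++ (map depthₜ ss) (map depthₜ ts))

-- The depth of the added letter is exactly the loss in `excess-moved`: n - p in case (a), n - q in
-- case (b).
depth-output : ∀ n (w : Permutation′ (suc n)) → depth (output w) ≡ excess w
depth-output = output-elim (λ w ts → depth ts ≡ excess w)
  (λ w → sym (trans (ℕ.+-identityʳ _) (ℕ.m≤n⇒m∸n≡0 (≤fromℕ (w ⟨$⟩ʳ zero)))))
  (λ w ts fix eq → trans (depth-extend ts) (trans eq (sym (excess-remove w fix))))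
  (λ {n} w ts wn≢n q≤p eq →
    let t′ = t-last (w ⟨$⟩ˡ fromℕ (suc n)) (from-last-≢ w wn≢n) in
    trans (depth-++ (extend ts) [ t′ ])
      (trans (cong₂ ℕ._+_ (trans (depth-extend ts) eq) (ℕ.+-identityʳ (depthₜ t′)))
        -- As q ≤ p, the truncated difference q ∸ p is zero.
        (sym (excess-moved w wn≢n (depthₜ t′) (cong (ℕ._+ depthₜ t′) (sym (ℕ.m≤n⇒m∸n≡0 q≤p)))))))
  (λ {n} w ts wn≢n p<q eq →
    let t = t-last (w ⟨$⟩ʳ fromℕ (suc n)) wn≢n in
    trans (cong (depthₜ t ℕ.+_) (trans (depth-extend ts) eq))
      (trans (ℕ.+-comm (depthₜ t) _)
        -- As p < q, the difference n - p splits at q.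
        (sym (excess-moved w wn≢n (depthₜ t) (∸-split (ℕ.<⇒≤ p<q) (≤fromℕ (w ⟨$⟩ʳ fromℕ (suc n))))))))

-- Inversions

𝟙 : {P : Set} → Dec P → ℕ
𝟙 P? = if does P? then 1 else 0

𝟙-true : {P : Set} (P? : Dec P) → P → 𝟙 P? ≡ 1
𝟙-true P? p rewrite dec-true P? p = refl

𝟙-false : {P : Set} (P? : Dec P) → ¬ P → 𝟙 P? ≡ 0
𝟙-false P? ¬p rewrite dec-false P? ¬p = refl

𝟙-cong : {P Q : Set} (P? : Dec P) (Q? : Dec Q) → (P → Q) → (Q → P) → 𝟙 P? ≡ 𝟙 Q?
𝟙-cong P? (yes q) P→Q Q→P = 𝟙-true P? (Q→P q)
𝟙-cong P? (no ¬q) P→Q Q→P = 𝟙-false P? (¬q ∘ P→Q)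

𝟙[<]-cong : {a b c d : Fin n} → a ≡ c → b ≡ d → 𝟙 (a <? b) ≡ 𝟙 (c <? d)
𝟙[<]-cong refl refl = refl

-- The order of positions and the order of values are separate factors, so that an exchange can be
-- moved from one to the other.
inv : Permutation′ n → ℕ
inv {n} x = ∑[ i < n ] (∑[ j < n ] (𝟙 (i <? j) ℕ.* 𝟙 (x ⟨$⟩ʳ j <? x ⟨$⟩ʳ i)))

inv-cong : (x y : Permutation′ n) → x ≈ y → inv x ≡ inv y
inv-cong x y x≈y = sum-cong-≗ λ i → sum-cong-≗ λ j →
  cong (𝟙 (i <? j) ℕ.*_) (𝟙[<]-cong (x≈y j) (x≈y i))

-- The iterated `at` is the point mass `c` at the pair (`k`, `l`).
sum-at₂ : ∀ c (k l : Fin n) → ∑[ i < n ] (∑[ j < n ] ((c at l) j at k) i) ≡ c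
sum-at₂ {n} c k l = begin
  ∑[ i < n ] (∑[ j < n ] ((c at l) j at k) i)
    ≡⟨ sum-single k (λ i i≢k → sum-zero {n} λ j → at-other i≢k) ⟩
  ∑[ j < n ] ((c at l) j at k) k
    ≡⟨ sum-cong-≗ (λ j → at-same ((c at l) j) k) ⟩
  ∑[ j < n ] (c at l) j
    ≡⟨ sum-at c l ⟩
  c ∎
  where open ≡-Reasoning

∑²-distrib-+ : (f g : Fin n → Fin n → ℕ) →
               ∑[ i < n ] (∑[ j < n ] (f i j ℕ.+ g i j)) ≡
               ∑[ i < n ] (∑[ j < n ] f i j) ℕ.+ ∑[ i < n ] (∑[ j < n ] g i j)
∑²-distrib-+ {n} f g = trans (sum-cong-≗ λ i → ∑-distrib-+ (f i) (g i))
  (∑-distrib-+ (λ i → ∑[ j < n ] f i j) (λ i → ∑[ j < n ] g i j))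

module _ {k l : Fin n} (adj : toℕ l ≡ suc (toℕ k)) where

  private
    s : Fin n → Fin n
    s = τ k l

    k<l : k < l
    k<l = ℕ.≤-reflexive (sym adj)

  -- No point lies strictly between `k` and `l`, so exchanging them reverses no other pair.
  τ-adjacent-mono : ∀ {i j} → i < j → ¬ (i ≡ k × j ≡ l) → s i < s j
  τ-adjacent-mono {i} {j} i<j ¬kl with s i | τ-view k l i | s j | τ-view k l j
  ... | _ | at-left refl    | _ | at-left refl    = contradiction i<j (ℕ.<-irrefl refl)
  ... | _ | at-left i≡k     | _ | at-right _ j≡l  = contradiction (i≡k , j≡l) ¬kl
  ... | _ | at-left refl    | _ | elsewhere _ j≢l = ≤∧≢⇒< (ℕ.≤-trans (ℕ.≤-reflexive adj) i<j) (≢-sym j≢l)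
  ... | _ | at-right _ _    | _ | at-left _       = k<l
  ... | _ | at-right _ refl | _ | at-right _ refl = contradiction i<j (ℕ.<-irrefl refl)
  ... | _ | at-right _ refl | _ | elsewhere _ _   = ℕ.<-trans k<l i<j
  ... | _ | elsewhere _ _   | _ | at-left refl    = ℕ.<-trans i<j k<l
  ... | _ | elsewhere i≢k _ | _ | at-right _ refl = ≤∧≢⇒< (ℕ.s≤s⁻¹ (ℕ.≤-trans i<j (ℕ.≤-reflexive adj))) i≢k
  ... | _ | elsewhere _ _   | _ | elsewhere _ _   = i<j

  𝟙-adjacent : ∀ i j → ¬ (i ≡ k × j ≡ l) → ¬ (i ≡ l × j ≡ k) → 𝟙 (s i <? s j) ≡ 𝟙 (i <? j)
  𝟙-adjacent i j ¬kl ¬lk = 𝟙-cong (s i <? s j) (i <? j)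
    -- The converse is the same monotonicity at (s i, s j), as `s` is an involution.
    (λ si<sj → subst₂ _<_ (τ-involutive k l i) (τ-involutive k l j)
      (τ-adjacent-mono si<sj λ (si≡k , sj≡l) → ¬lk
        ( trans (sym (τ-involutive k l i)) (trans (cong s si≡k) (τ-left k l))
        , trans (sym (τ-involutive k l j)) (trans (cong s sj≡l) (τ-right k l)))))
    (λ i<j → τ-adjacent-mono i<j ¬kl)

  -- The two orders differ only at (k, l) and (l, k), in opposite directions. A point mass on each
  -- side balances this without subtraction.
  order-adjacent : (b : Fin n → Fin n → ℕ) → ∀ i j →
    𝟙 (s i <? s j) ℕ.* b i j ℕ.+ ((b k l at l) j at k) i ≡
    𝟙 (i <? j) ℕ.* b i j ℕ.+ ((b l k at k) j at l) i
  order-adjacent b i j with i ≟ k ×-dec j ≟ l | i ≟ l ×-dec j ≟ k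
  ... | yes (refl , refl) | _
    rewrite τ-left i j | τ-right i j | at-same ((b i j at j) j) i | at-same (b i j) j
          | at-other {c = (b j i at i) j} (<⇒≢ k<l)
          | 𝟙-true (i <? j) k<l | 𝟙-false (j <? i) (ℕ.<⇒≯ k<l)
    = trans (sym (ℕ.+-identityʳ (b i j))) (sym (ℕ.+-identityʳ (b i j ℕ.+ 0)))
  ... | no _ | yes (refl , refl)
    rewrite τ-left j i | τ-right j i | at-same ((b i j at j) j) i | at-same (b i j) j
          | at-other {c = (b j i at i) j} (≢-sym (<⇒≢ k<l))
          | 𝟙-true (j <? i) k<l | 𝟙-false (i <? j) (ℕ.<⇒≯ k<l)
    = trans (ℕ.+-identityʳ (b i j ℕ.+ 0)) (ℕ.+-identityʳ (b i j))
  ... | no ¬kl | no ¬lk = cong₂ ℕ._+_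
    (cong (ℕ._* b i j) (𝟙-adjacent i j ¬kl ¬lk))
    (trans (at₂-other ¬kl) (sym (at₂-other ¬lk)))
    where
    at₂-other : ∀ {c} {i j k l : Fin n} → ¬ (i ≡ k × j ≡ l) → ((c at l) j at k) i ≡ 0
    at₂-other {c} {i} {j} {k} {l} ¬kl with i ≟ k
    ... | no  _   = refl
    ... | yes i≡k = at-other (λ j≡l → ¬kl (i≡k , j≡l))

  -- Reindexing by the transposition moves it from the values to the positions, where it
  -- reverses the order of the pair (k, l) only.
  inv-·-adjacent : (x : Permutation′ n) →
    inv (x · transpose k l) ℕ.+ 𝟙 (x ⟨$⟩ʳ l <? x ⟨$⟩ʳ k) ≡ inv x ℕ.+ 𝟙 (x ⟨$⟩ʳ k <? x ⟨$⟩ʳ l)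
  inv-·-adjacent x = begin
    inv (x · transpose k l) ℕ.+ b k l
      ≡⟨ cong (ℕ._+ b k l) (sum-cong-≗ λ i → sum-cong-≗ λ j → cong (ℕ._* b (s i) (s j))
           (𝟙[<]-cong (sym (τ-involutive k l i)) (sym (τ-involutive k l j)))) ⟩
    ∑[ i < n ] (∑[ j < n ] f (s i) (s j)) ℕ.+ b k l
      ≡⟨ cong (ℕ._+ b k l) (sum-cong-≗ λ i → sum-permute (f (s i)) (transpose k l)) ⟨
    ∑[ i < n ] (∑[ j < n ] f (s i) j) ℕ.+ b k l
      ≡⟨ cong (ℕ._+ b k l) (sum-permute (λ i → ∑[ j < n ] f i j) (transpose k l)) ⟨
    ∑[ i < n ] (∑[ j < n ] f i j) ℕ.+ b k l
      ≡⟨ cong (∑[ i < n ] (∑[ j < n ] f i j) ℕ.+_) (sum-at₂ (b k l) k l) ⟨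
    ∑[ i < n ] (∑[ j < n ] f i j) ℕ.+ ∑[ i < n ] (∑[ j < n ] ((b k l at l) j at k) i)
      ≡⟨ ∑²-distrib-+ f (λ i j → ((b k l at l) j at k) i) ⟨
    ∑[ i < n ] (∑[ j < n ] (f i j ℕ.+ ((b k l at l) j at k) i))
      ≡⟨ sum-cong-≗ (λ i → sum-cong-≗ (order-adjacent b i)) ⟩
    ∑[ i < n ] (∑[ j < n ] (g i j ℕ.+ ((b l k at k) j at l) i))
      ≡⟨ ∑²-distrib-+ g (λ i j → ((b l k at k) j at l) i) ⟩
    inv x ℕ.+ ∑[ i < n ] (∑[ j < n ] ((b l k at k) j at l) i)
      ≡⟨ cong (inv x ℕ.+_) (sum-at₂ (b l k) l k) ⟩
    inv x ℕ.+ b l k ∎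
    where
    open ≡-Reasoning
    b f g : Fin n → Fin n → ℕ
    b i j = 𝟙 (x ⟨$⟩ʳ j <? x ⟨$⟩ʳ i)
    f i j = 𝟙 (s i <? s j) ℕ.* b i j
    g i j = 𝟙 (i <? j) ℕ.* b i j

  inv-ascent : (x : Permutation′ n) → x ⟨$⟩ʳ k < x ⟨$⟩ʳ l → inv (x · transpose k l) ≡ suc (inv x)
  inv-ascent x xk<xl = begin
    inv (x · transpose k l)        ≡⟨ ℕ.+-identityʳ _ ⟨
    inv (x · transpose k l) ℕ.+ 0  ≡⟨ cong (inv (x · transpose k l) ℕ.+_) (𝟙-false (_ <? _) (ℕ.<⇒≯ xk<xl)) ⟨
    inv (x · transpose k l) ℕ.+ 𝟙 (x ⟨$⟩ʳ l <? x ⟨$⟩ʳ k) ≡⟨ inv-·-adjacent x ⟩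
    inv x ℕ.+ 𝟙 (x ⟨$⟩ʳ k <? x ⟨$⟩ʳ l) ≡⟨ cong (inv x ℕ.+_) (𝟙-true (_ <? _) xk<xl) ⟩
    inv x ℕ.+ 1                    ≡⟨ ℕ.+-comm (inv x) 1 ⟩
    suc (inv x)                    ∎
    where open ≡-Reasoning

  -- A descent of x is an ascent of x·s, and (x·s)·s = x.
  inv-descent : (x : Permutation′ n) → x ⟨$⟩ʳ l < x ⟨$⟩ʳ k → inv x ≡ suc (inv (x · transpose k l))
  inv-descent x xl<xk = begin
    inv x                                       ≡⟨ inv-cong x (x · transpose k l · transpose k l)
                                                     (λ i → cong (x ⟨$⟩ʳ_) (sym (τ-involutive k l i))) ⟩
    inv (x · transpose k l · transpose k l)     ≡⟨ inv-ascent (x · transpose k l)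
                                                     (subst₂ (λ a b → x ⟨$⟩ʳ a < x ⟨$⟩ʳ b)
                                                       (sym (τ-left k l)) (sym (τ-right k l)) xl<xk) ⟩
    suc (inv (x · transpose k l))               ∎
    where open ≡-Reasoning

  inv-·-adjacent-≤ : (x : Permutation′ n) → inv (x · transpose k l) ℕ.≤ suc (inv x)
  inv-·-adjacent-≤ x with <-cmp (x ⟨$⟩ʳ k) (x ⟨$⟩ʳ l)
  ... | tri< xk<xl _ _ = ℕ.≤-reflexive (inv-ascent x xk<xl)
  ... | tri≈ _ xk≡xl _ = contradiction (cong toℕ (⟨$⟩ʳ-injective x xk≡xl)) (ℕ.<⇒≢ k<l)
  ... | tri> _ _ xl<xk = ℕ.m≤n⇒m≤1+n (ℕ.≤-trans (ℕ.n≤1+n _) (ℕ.≤-reflexive (sym (inv-descent x xl<xk))))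

-- The length as the number of inversions

inv-id : ∀ n → inv (id {n}) ≡ 0
inv-id n = sum-zero {n} λ i → sum-zero {n} λ j → term i j
  where
  term : ∀ (i j : Fin n) → 𝟙 (i <? j) ℕ.* 𝟙 (j <? i) ≡ 0
  term i j with i <? j
  ... | yes i<j = trans (cong (𝟙 (i <? j) ℕ.*_) (𝟙-false (j <? i) (ℕ.<⇒≯ i<j))) (ℕ.*-zeroʳ (𝟙 (i <? j)))
  ... | no  i≮j = cong (ℕ._* 𝟙 (j <? i)) (𝟙-false (i <? j) i≮j)

-- The effect of an adjacent letter is known for multiplication on the right, so `x` accumulates the
-- letters already read.
inv-·-∏ : (x : Permutation′ n) (ts : Word n) → All Adjacent ts →
          inv (x · ∏ ts) ℕ.≤ inv x ℕ.+ length ts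
inv-·-∏ x []       []           = ℕ.≤-reflexive (sym (ℕ.+-identityʳ (inv x)))
inv-·-∏ x (t ∷ ts) (adj ∷ adjs) = begin
  inv (x · ⟦ t ⟧ · ∏ ts)           ≤⟨ inv-·-∏ (x · ⟦ t ⟧) ts adjs ⟩
  inv (x · ⟦ t ⟧) ℕ.+ length ts    ≤⟨ ℕ.+-monoˡ-≤ (length ts) (inv-·-adjacent-≤ adj x) ⟩
  suc (inv x) ℕ.+ length ts        ≡⟨ sym (ℕ.+-suc (inv x) (length ts)) ⟩
  inv x ℕ.+ length (t ∷ ts)        ∎
  where open ℕ.≤-Reasoning

inv≤length : (ts : Word n) → All Adjacent ts → inv (∏ ts) ℕ.≤ length ts
inv≤length {n} ts adj = ℕ.≤-trans (inv-·-∏ id ts adj) (ℕ.≤-reflexive (cong (ℕ._+ length ts) (inv-id n)))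

-- Strict growth gives i ≤ x(i) by induction upwards from the least point, and x(i) ≤ i by induction
-- downwards from the largest.
ascending⇒id : (x : Permutation′ (suc n)) →
               (∀ i → x ⟨$⟩ʳ inject₁ i < x ⟨$⟩ʳ suc i) → id ≈ x
ascending⇒id {n} x asc i = ≤-antisym
  (<-weakInduction (λ i → i ≤ x ⟨$⟩ʳ i) z≤n
    (λ i i≤xi → ℕ.≤-<-trans (subst (ℕ._≤ toℕ (x ⟨$⟩ʳ inject₁ i)) (toℕ-inject₁ i) i≤xi) (asc i)) i)
  (>-weakInduction (λ i → x ⟨$⟩ʳ i ≤ i) (≤fromℕ _)
    (λ i xi≤i → subst (toℕ (x ⟨$⟩ʳ inject₁ i) ℕ.≤_) (sym (toℕ-inject₁ i))
                  (ℕ.s≤s⁻¹ (ℕ.<-≤-trans (asc i) xi≤i))) i)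

-- Bubble sort: each descent is removed by an adjacent letter on the right, which costs exactly one
-- inversion; without descents only the identity remains.
reduced-word : ∀ m (x : Permutation′ (suc n)) → inv x ≡ m →
               ∃[ ts ] ((All Adjacent ts × ∏ ts ≈ x) × length ts ≡ m)
reduced-word {n} m x inv≡m with any? (λ i → x ⟨$⟩ʳ suc i <? x ⟨$⟩ʳ inject₁ i)
... | no ¬desc = [] , ([] , x≈id) , trans (sym (inv-id (suc n))) (trans (inv-cong id x x≈id) inv≡m)
  where
  x≈id : id ≈ x
  x≈id = ascending⇒id x λ i → ≤∧≢⇒< (ℕ.≮⇒≥ λ desc → ¬desc (i , desc))
    λ eq → ℕ.<⇒≢ (ℕ.≤-reflexive (cong suc (toℕ-inject₁ i))) (cong toℕ (⟨$⟩ʳ-injective x eq))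
... | yes (i , desc) = go m inv≡m
  where
  adj : toℕ (suc i) ≡ suc (toℕ (inject₁ i))
  adj = cong suc (sym (toℕ-inject₁ i))
  t : Transposition (suc n)
  t = t⟨ inject₁ i , suc i , ℕ.≤-reflexive (sym adj) ⟩
  go : ∀ m → inv x ≡ m → ∃[ ts ] ((All Adjacent ts × ∏ ts ≈ x) × length ts ≡ m)
  -- A permutation with a descent has a positive number of inversions.
  go zero    inv≡0 = contradiction (trans (sym (inv-descent adj x desc)) inv≡0) λ ()
  go (suc m) inv≡1+m
    with reduced-word m (x · ⟦ t ⟧) (ℕ.suc-injective (trans (sym (inv-descent adj x desc)) inv≡1+m))
  ... | ts , (adjs , ∏ts≈) , len =
    ts ++ [ t ] , (++⁺ adjs (adj ∷ []) , λ k → trans (∏-++ ts [ t ] k)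
        (trans (∏ts≈ (⟦ t ⟧ ⟨$⟩ʳ k)) (cong (x ⟨$⟩ʳ_) (τ-involutive (lo t) (hi t) k))))
    , trans (length-++ ts) (trans (ℕ.+-comm _ 1) (cong suc len))

inv-isLength : (x : Permutation′ (suc n)) → IsLength x (inv x)
inv-isLength x = reduced-word (inv x) x refl ,
  λ ts (adj , eq) → ℕ.≤-trans (ℕ.≤-reflexive (inv-cong x (∏ ts) (λ i → sym (eq i)))) (inv≤length ts adj)

-- Induction on the upper point by (i j+1) = s(i j)s with s = (j j+1). The inner factor gains at
-- least one inversion by induction; the two factors s must be shown not to lose more than they
-- gain.
inv-·-transpose : (i j : Fin (suc n)) → i < j → (x : Permutation′ (suc n)) →
                  x ⟨$⟩ʳ i < x ⟨$⟩ʳ j → inv x ℕ.< inv (x · transpose i j)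
inv-·-transpose {n} i = <-weakInduction
  (λ j → i < j → ∀ x → x ⟨$⟩ʳ i < x ⟨$⟩ʳ j → inv x ℕ.< inv (x · transpose i j))
  (λ ())
  step
  where
  step : ∀ j → (i < inject₁ j → ∀ x → x ⟨$⟩ʳ i < x ⟨$⟩ʳ inject₁ j →
          inv x ℕ.< inv (x · transpose i (inject₁ j))) →
         i < suc j → ∀ x → x ⟨$⟩ʳ i < x ⟨$⟩ʳ suc j → inv x ℕ.< inv (x · transpose i (suc j))
  step j ih i<1+j x xi<x1+j with i ≟ inject₁ j
  ... | yes refl = ℕ.≤-reflexive (sym (inv-ascent (cong suc (sym (toℕ-inject₁ j))) x xi<x1+j))
  ... | no  i≢j  = main
    where
    open ℕ.≤-Reasoning
    j′ = inject₁ j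
    k  = suc j
    adj : toℕ k ≡ suc (toℕ j′)
    adj = cong suc (sym (toℕ-inject₁ j))
    s = transpose j′ k
    y = x · s
    z = y · transpose i j′
    i<j′ : i < j′
    i<j′ = ≤∧≢⇒< (subst (toℕ i ℕ.≤_) (sym (toℕ-inject₁ j)) (ℕ.s≤s⁻¹ i<1+j)) i≢j
    i≢k : i ≢ k
    i≢k i≡k = ℕ.<⇒≢ i<1+j (cong toℕ i≡k)
    k≢j′ : k ≢ j′
    k≢j′ k≡j′ = ℕ.<⇒≢ (ℕ.≤-reflexive (sym adj)) (cong toℕ (sym k≡j′))
    si≡i : τ j′ k i ≡ i
    si≡i = τ-other i≢j i≢k
    z·s≈ : z · s ≈ x · transpose i k
    z·s≈ v = cong (x ⟨$⟩ʳ_) (conj v)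
      where
      conj : ∀ v → τ j′ k (τ i j′ (τ j′ k v)) ≡ τ i k v
      conj v = trans (τ-conjugate (τ j′ k) (⟨$⟩ʳ-injective s) i j′ (τ j′ k v))
        (trans (cong₂ (λ a b → τ a b (τ j′ k (τ j′ k v))) si≡i (τ-left j′ k))
          (cong (τ i k) (τ-involutive j′ k v)))
    inv-y<z : inv y ℕ.< inv z
    inv-y<z = ih i<j′ y (subst₂ (λ a b → x ⟨$⟩ʳ a < x ⟨$⟩ʳ b) (sym si≡i) (sym (τ-left j′ k)) xi<x1+j)
    zj′≡xi : z ⟨$⟩ʳ j′ ≡ x ⟨$⟩ʳ i
    zj′≡xi = cong (x ⟨$⟩ʳ_) (trans (cong (τ j′ k) (τ-right i j′)) si≡i)
    zk≡xj′ : z ⟨$⟩ʳ k ≡ x ⟨$⟩ʳ j′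
    zk≡xj′ = cong (x ⟨$⟩ʳ_) (trans (cong (τ j′ k) (τ-other (≢-sym i≢k) k≢j′)) (τ-right j′ k))
    -- The bound for one adjacent letter is applied to z·s, since (z·s)·s = z.
    z≤z·s : inv z ℕ.≤ suc (inv (x · transpose i k))
    z≤z·s = begin
      inv z                            ≡⟨ inv-cong (z · s · s) z (λ v → cong (z ⟨$⟩ʳ_) (τ-involutive j′ k v)) ⟨
      inv (z · s · s)                  ≤⟨ inv-·-adjacent-≤ adj (z · s) ⟩
      suc (inv (z · s))                ≡⟨ cong suc (inv-cong (z · s) (x · transpose i k) z·s≈) ⟩
      suc (inv (x · transpose i k))    ∎
    main : inv x ℕ.< inv (x · transpose i k)
    main with <-cmp (x ⟨$⟩ʳ j′) (x ⟨$⟩ʳ k)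
    -- The first s gains one inversion, which pays for the at most one lost by the second.
    ... | tri< asc _ _ = ℕ.s≤s⁻¹ (begin
      suc (suc (inv x))                ≡⟨ cong suc (inv-ascent adj x asc) ⟨
      suc (inv y)                      ≤⟨ inv-y<z ⟩
      inv z                            ≤⟨ z≤z·s ⟩
      suc (inv (x · transpose i k))    ∎)
    ... | tri≈ _ eq _ = contradiction (⟨$⟩ʳ-injective x (sym eq)) k≢j′
    -- The first s loses one inversion. Then x(i) < x(j+1) < x(j), so the second s acts on an ascent
    -- of z and regains it.
    ... | tri> _ _ desc = begin
      suc (inv x)                      ≡⟨ cong suc (inv-descent adj x desc) ⟩
      suc (suc (inv y))                ≤⟨ s≤s inv-y<z ⟩
      suc (inv z)                      ≡⟨ inv-ascent adj z
                                            (subst₂ _<_ (sym zj′≡xi) (sym zk≡xj′) (ℕ.<-trans xi<x1+j desc)) ⟨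
      inv (z · s)                      ≡⟨ inv-cong (z · s) (x · transpose i k) z·s≈ ⟩
      inv (x · transpose i k)          ∎

-- Bruhat path

-- `x` is the product of the letters already read. Multiplying it on the right by `t` exchanges the
-- values at `lo t` and `hi t`, and `R` constrains these values.
data Steps {n} (R : Fin n → Fin n → Set) (x : Permutation′ n) : Word n → Set where
  []  : Steps R x []
  _∷_ : ∀ {t ts} → R (x ⟨$⟩ʳ lo t) (x ⟨$⟩ʳ hi t) → Steps R (x · ⟦ t ⟧) ts → Steps R x (t ∷ ts)

steps-map : {R S : Fin n → Fin n → Set} {x : Permutation′ n} {ts : Word n} →
            (∀ {a b} → R a b → S a b) → Steps R x ts → Steps S x ts
steps-map R⇒S []       = []
steps-map R⇒S (r ∷ rs) = R⇒S r ∷ steps-map R⇒S rs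

steps-snoc : {R : Fin n → Fin n → Set} (x : Permutation′ n) {ts : Word n} {t : Transposition n} →
             Steps R x ts → R (x · ∏ ts ⟨$⟩ʳ lo t) (x · ∏ ts ⟨$⟩ʳ hi t) → Steps R x (ts ++ [ t ])
steps-snoc x []                 r = r ∷ []
steps-snoc x (_∷_ {t} r₀ rs)    r = r₀ ∷ steps-snoc (x · ⟦ t ⟧) rs r

-- Right multiplication acts on positions, so a translation `φ` of values survives every step. It is
-- `inject₁` for a path from the identity, and a transposition after `inject₁` when a letter has
-- been prepended.
steps-extend : {R : Fin n → Fin n → Set} {S : Fin (suc n) → Fin (suc n) → Set}
               (φ : Fin n → Fin (suc n)) → (∀ {a b} → R a b → S (φ a) (φ b)) →
               (x : Permutation′ n) (y : Permutation′ (suc n)) → (∀ i → y ⟨$⟩ʳ inject₁ i ≡ φ (x ⟨$⟩ʳ i)) →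
               {ts : Word n} → Steps R x ts → Steps S y (extend ts)
steps-extend φ R⇒S x y y≗φx [] = []
steps-extend {S = S} φ R⇒S x y y≗φx (_∷_ {t} r rs) =
  subst₂ S (sym (y≗φx (lo t))) (sym (y≗φx (hi t))) (R⇒S r) ∷
  steps-extend φ R⇒S (x · ⟦ t ⟧) (y · ⟦ extendₜ t ⟧)
    (λ i → trans (cong (y ⟨$⟩ʳ_) (sym (τ-conjugate inject₁ inject₁-injective (lo t) (hi t) i)))
                 (y≗φx (⟦ t ⟧ ⟨$⟩ʳ i))) rs

inject₁-mono-< : {a b : Fin n} → a < b → inject₁ a < inject₁ b
inject₁-mono-< {a = a} {b} = subst₂ ℕ._<_ (sym (toℕ-inject₁ a)) (sym (toℕ-inject₁ b))

inject₁<last : (a : Fin n) → inject₁ a < fromℕ n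
inject₁<last a = ≤∧≢⇒< (≤fromℕ (inject₁ a)) (≢-sym fromℕ≢inject₁)

⟨$⟩ˡ-≡ : (w : Permutation′ n) {i j : Fin n} → w ⟨$⟩ʳ i ≡ j → w ⟨$⟩ˡ j ≡ i
⟨$⟩ˡ-≡ w eq = trans (cong (w ⟨$⟩ˡ_) (sym eq)) (inverseˡ w)

-- A step that exchanges the values a < b moves a to the right, so a should be one of
-- the values that end up to the right of their initial position.
RightMove : Permutation′ n → Fin n → Fin n → Set
RightMove w a b = a < b × a < w ⟨$⟩ˡ a

module _ (w : Permutation′ (suc n)) where

  private
    l = fromℕ n
    q = w ⟨$⟩ʳ l
    p = w ⟨$⟩ˡ l

  ⟨$⟩ˡ-remove : FixesLast w → ∀ a → w ⟨$⟩ˡ inject₁ a ≡ inject₁ (remove l w ⟨$⟩ˡ a)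
  ⟨$⟩ˡ-remove fix a = ⟨$⟩ˡ-≡ w (trans (inject₁-remove w fix (remove l w ⟨$⟩ˡ a))
                                 (cong inject₁ (inverseʳ (remove l w))))

  rightMove-fixed : FixesLast w → ∀ {a b} → RightMove (remove l w) a b → RightMove w (inject₁ a) (inject₁ b)
  rightMove-fixed fix {a} (a<b , a<w⁻¹a) =
    inject₁-mono-< a<b , subst (inject₁ a <_) (sym (⟨$⟩ˡ-remove fix a)) (inject₁-mono-< a<w⁻¹a)

  module _ (wn≢n : q ≢ l) where

    private
      t  = t-last q wn≢n
      w′ = remove l (⟦ t ⟧ · w)

    rightMove-last : RightMove w q l
    rightMove-last = lo<hi t , subst (q <_) (sym (inverseˡ w)) (lo<hi t)

    w′⁻¹-spec : ∀ a → w ⟨$⟩ʳ inject₁ (w′ ⟨$⟩ˡ a) ≡ τ q l (inject₁ a)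
    w′⁻¹-spec a = trans (sym (τ-involutive q l (w ⟨$⟩ʳ inject₁ (w′ ⟨$⟩ˡ a))))
      (cong (τ q l) (trans (inject₁-remove (⟦ t ⟧ · w) (τ-left q l) (w′ ⟨$⟩ˡ a))
                       (cong inject₁ (inverseʳ w′))))

    w′⁻¹-other : ∀ a → inject₁ a ≢ q → w ⟨$⟩ˡ inject₁ a ≡ inject₁ (w′ ⟨$⟩ˡ a)
    w′⁻¹-other a a≢q = ⟨$⟩ˡ-≡ w (trans (w′⁻¹-spec a) (τ-other a≢q (≢-sym fromℕ≢inject₁)))

    w′⁻¹-q : ∀ a → inject₁ a ≡ q → p ≡ inject₁ (w′ ⟨$⟩ˡ a)
    w′⁻¹-q a a≡q = ⟨$⟩ˡ-≡ w (trans (w′⁻¹-spec a) (trans (cong (τ q l) a≡q) (τ-left q l)))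

    -- Values below n other than q have the same position in w and w′, while q stands at position n
    -- in w, to the right of itself.
    rightMove-inject₁ : ∀ {a b} → RightMove w′ a b → RightMove w (inject₁ a) (inject₁ b)
    rightMove-inject₁ {a} (a<b , a<w′⁻¹a) with inject₁ a ≟ q
    ... | yes a≡q = inject₁-mono-< a<b ,
                    subst (inject₁ a <_) (sym (⟨$⟩ˡ-≡ w (sym a≡q))) (inject₁<last a)
    ... | no  a≢q = inject₁-mono-< a<b ,
                    subst (inject₁ a <_) (sym (w′⁻¹-other a a≢q)) (inject₁-mono-< a<w′⁻¹a)

    -- If p < q, the value q ends to the left of its position in w′, hence is never moved right.
    rightMove-τ : p < q → ∀ {a b} → RightMove w′ a b →
                  RightMove w (τ q l (inject₁ a)) (τ q l (inject₁ b))
    rightMove-τ p<q {a} {b} (a<b , a<w′⁻¹a) =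
      subst (λ c → RightMove w c (τ q l (inject₁ b))) (sym (τ-other a≢q (≢-sym fromℕ≢inject₁)))
        (a<τb , subst (inject₁ a <_) (sym (w′⁻¹-other a a≢q)) (inject₁-mono-< a<w′⁻¹a))
      where
      a≢q : inject₁ a ≢ q
      a≢q a≡q = ℕ.<-asym p<q (subst₂ _<_ a≡q (sym (w′⁻¹-q a a≡q)) (inject₁-mono-< a<w′⁻¹a))
      a<τb : inject₁ a < τ q l (inject₁ b)
      -- If b is q, it is replaced by n, which still exceeds a.
      a<τb with τ q l (inject₁ b) | τ-view q l (inject₁ b)
      ... | _ | at-left _      = inject₁<last a
      ... | _ | at-right _ b≡l = contradiction (sym b≡l) fromℕ≢inject₁
      ... | _ | elsewhere _ _  = inject₁-mono-< a<b

-- The product and the steps are proved together because the appended step in case (a) needs the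
-- product of the letters before it.
output-correct : ∀ n (w : Permutation′ (suc n)) →
                 ∏ (output w) ≈ w × Steps (RightMove w) id (output w)
output-correct = output-elim (λ w ts → ∏ ts ≈ w × Steps (RightMove w) id ts)
  (λ w → (λ { zero → Fin1-irrelevant zero (w ⟨$⟩ʳ zero) }) , [])
  (λ w ts fix (eq , steps) → ∏-extend w fix ts eq ,
    steps-extend inject₁ (rightMove-fixed w fix) id id (λ _ → refl) steps)
  (λ {n} w ts wn≢n _ (eq , steps) →
    let t  = t-last (w ⟨$⟩ʳ fromℕ (suc n)) wn≢n
        x≈ = ∏-extend (⟦ t ⟧ · w) (τ-left (lo t) (hi t)) ts eq
    in ∏-extend-snoc w wn≢n ts eq ,
       steps-snoc id (steps-extend inject₁ (rightMove-inject₁ w wn≢n) id id (λ _ → refl) steps)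
         -- Before the appended letter the product is t·w, which has value q at position w⁻¹(n) and
         -- value n at position n.
         (subst₂ (RightMove w)
           (sym (trans (x≈ (w ⟨$⟩ˡ fromℕ (suc n)))
                  (trans (cong (⟦ t ⟧ ⟨$⟩ʳ_) (inverseʳ w)) (τ-right (lo t) (hi t)))))
           (sym (trans (x≈ (fromℕ (suc n))) (τ-left (lo t) (hi t))))
           (rightMove-last w wn≢n)))
  (λ {n} w ts wn≢n p<q (eq , steps) →
    let t = t-last (w ⟨$⟩ʳ fromℕ (suc n)) wn≢n
    in ∏-cons-extend w wn≢n ts eq ,
       rightMove-last w wn≢n ∷
       -- The remaining path starts at t, so all its values are seen through t.
       steps-extend (λ a → τ (lo t) (hi t) (inject₁ a)) (rightMove-τ w wn≢n p<q) id (id · ⟦ t ⟧)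
         (λ _ → refl) steps)
  where
  Fin1-irrelevant : (i j : Fin 1) → i ≡ j
  Fin1-irrelevant zero zero = refl

-- `F` stands for the product of a prefix preceded by the letters already read. It agrees with
-- `x · ∏ ts` only pointwise, so inversion numbers are transported along `≈`.
steps⇒linked : (F : Word (suc n) → Permutation′ (suc n)) (x : Permutation′ (suc n)) →
               (∀ ts → F ts ≈ x · ∏ ts) → {ts : Word (suc n)} → Steps _<_ x ts →
               Linked _⟶_ (map F (inits ts))
steps⇒linked F x F≈ [] = [-]
steps⇒linked F x F≈ (_∷_ {t} {ts} r rs) =
  -- The recursive call maps the composite `F ∘ (t ∷_)`; `map-∘` splits it as `inits` does.
  edge ∷ subst (λ ys → Linked _⟶_ (F [ t ] ∷ ys)) (map-∘ _)
           (steps⇒linked (F ∘ (t ∷_)) (x · ⟦ t ⟧) (λ ys → F≈ (t ∷ ys)) rs)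
  where
  edge : F [] ⟶ F [ t ]
  edge = (t , λ i → trans (F≈ [ t ] i) (sym (F≈ [] (⟦ t ⟧ ⟨$⟩ʳ i)))) ,
    inv (F []) , inv (F [ t ]) , inv-isLength (F []) , inv-isLength (F [ t ]) ,
    subst₂ ℕ._<_ (inv-cong x (F []) (λ i → sym (F≈ [] i)))
                  (inv-cong (x · ⟦ t ⟧) (F [ t ]) (λ i → sym (F≈ [ t ] i)))
      (inv-·-transpose (lo t) (hi t) (lo<hi t) x r)

theorem3p1 : ∀ (n : ℕ) (w : Permutation′ (suc n)) →
    let u , v = shallowDecomp n w
        ts    = u ++ v
    in
    (∏ ts ≈ w)
    × IsReflectionLength w (length ts)
    × IsDp w (depth ts)
    × IsDp w (excedanceSum w)
    × IsBruhatPath ts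
theorem3p1 n w =
    correct
  , ((output w , correct , refl) , output-shortest n w)
  , minimalDepth
  , subst (IsDp w) (trans (depth-output n w) (sym (excedanceSum≡excess w))) minimalDepth
  , steps⇒linked ∏ id (λ _ _ → refl) (steps-map proj₁ steps)
  where
  correct = proj₁ (output-correct n w)
  steps   = proj₂ (output-correct n w)
  minimalDepth : IsDp w (depth (output w))
  minimalDepth = (output w , correct , refl) , λ ss eq → begin
    depth (output w)  ≡⟨ depth-output n w ⟩
    -- `excess` depends only on the permutation, so it bounds the depth of every word for `w` from
    -- below.
    excess w          ≡⟨ excess-cong w (∏ ss) (λ i → sym (eq i)) ⟩
    excess (∏ ss)     ≤⟨ excess-∏≤depth ss ⟩
    depth ss          ∎
    where open ℕ.≤-Reasoning
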